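{- For each positive integer $n$, the age of $n*I_\omega^*$ has the Ramsey property.
   Context: In a directed graph, write $x\perp y$ iff neither $(x,y)$ nor $(y,x)$ is an edge. A complete $n$-partite directed graph is one in which $\perp$ is an equivalence relation with at most $n$ classes (parts). $n*I_\omega$ is the Fraïssé limit of the class of finite complete $n$-partite directed graphs. $n*I_\omega^*$ is the expansion of $n*I_\omega$ by unary predicates $P_0,\dots,P_{n-1}$ naming the parts and a linear order $<$ convex with respect to the parts with $P_0<\dots<P_{n-1}$; its age consists of all finite structures $(A,E,P_0,\dots,P_{n-1},<)$ where $(A,E)$ is a complete $n$-partite directed graph whose parts are the nonempty $P_i$'s and $<$ is a linear order with $P_0<\dots<P_{n-1}$. A class $\mathcal K$ of finite structures has the Ramsey property if for all $k\in\mathbb N$ and $\mathbf A,\mathbf B\in\mathcal K$ there is $\mathbf C\in\mathcal K$ such that for every colouring of the substructures of $\mathbf C$ isomorphic to $\mathbf A$ with $k$ colours there is a substructure $\mathbf B'\cong\mathbf B$ of $\mathbf C$ on whose substructures isomorphic to $\mathbf A$ the colouring is constant. -}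

module Defs where

open import Data.Nat using (ℕ)
open import Data.Fin using (Fin) renaming (_<_ to _<ᶠ_)
open import Data.Fin.Subset using (Subset; _∈_; _⊆_)
open import Data.Bool using (Bool; true; false)
open import Data.Product using (Σ; ∃; _×_; _,_)
open import Data.Sum using (_⊎_)
open import Relation.Binary.PropositionalEquality using (_≡_; _≢_)
open import Function.Definitions using (Injective)

-- A finite structure in the language (E, P₀,…,P_{n-1}, <), universe Fin size.
-- Relations are Bool-valued (decidable), no loss for finite structures.
record Str (n : ℕ) : Set where
  field
    size : ℕ
    E    : Fin size → Fin size → Bool
    P    : Fin n → Fin size → Bool
    lt   : Fin size → Fin size → Bool
open Str public

Perp : ∀ {n} (A : Str n) → Fin (size A) → Fin (size A) → Set
Perp A x y = (E A x y ≡ false) × (E A y x ≡ false)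

-- (A, E) is a directed graph (irreflexive, no 2-cycles; Cherlin's convention)
IsDigraph : ∀ {n} → Str n → Set
IsDigraph A = (∀ x → E A x x ≡ false)
            × (∀ x y → E A x y ≡ true → E A y x ≡ false)

IsLinearOrder : ∀ {n} → Str n → Set
IsLinearOrder A = (∀ x → lt A x x ≡ false)
                × (∀ x y z → lt A x y ≡ true → lt A y z ≡ true → lt A x z ≡ true)
                × (∀ x y → x ≢ y → (lt A x y ≡ true) ⊎ (lt A y x ≡ true))

PartsPartition : ∀ {n} → Str n → Set
PartsPartition {n} A = (∀ x → ∃ λ (i : Fin n) → P A i x ≡ true)
                     × (∀ (i j : Fin n) x → P A i x ≡ true → P A j x ≡ true → i ≡ j)

-- the ⊥-classes are exactly the nonempty P_i (so (A,E) is complete n-partite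
-- with parts the nonempty P_i)
PartsArePerpClasses : ∀ {n} → Str n → Set
PartsArePerpClasses {n} A =
  ∀ x y → (Perp A x y → ∃ λ (i : Fin n) → (P A i x ≡ true) × (P A i y ≡ true))
        × (∀ (i : Fin n) → P A i x ≡ true → P A i y ≡ true → Perp A x y)

PartsOrdered : ∀ {n} → Str n → Set
PartsOrdered {n} A = ∀ (i j : Fin n) x y → i <ᶠ j →
  P A i x ≡ true → P A j y ≡ true → lt A x y ≡ true

InAge : (n : ℕ) → Str n → Set
InAge n A = IsDigraph A × IsLinearOrder A × PartsPartition A
          × PartsArePerpClasses A × PartsOrdered A

IsEmbedding : ∀ {n} (A C : Str n) → (Fin (size A) → Fin (size C)) → Set
IsEmbedding {n} A C f = Injective _≡_ _≡_ f
  × (∀ x y → E C (f x) (f y) ≡ E A x y)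
  × (∀ x y → lt C (f x) (f y) ≡ lt A x y)
  × (∀ (i : Fin n) x → P C i (f x) ≡ P A i x)

IsCopy : ∀ {n} (A C : Str n) → Subset (size C) → Set
IsCopy A C S = ∃ λ (f : Fin (size A) → Fin (size C)) → IsEmbedding A C f
  × (∀ z → (z ∈ S → ∃ λ x → f x ≡ z) × (∀ x → f x ≡ z → z ∈ S))

-- Ramsey property of a class K of finite structures.
-- A colouring of the copies of A in C is given as a colouring of all subsets
-- of C (values on non-copies are irrelevant).
RamseyProperty : ∀ {n} → (Str n → Set) → Set
RamseyProperty {n} K = ∀ (k : ℕ) (A B : Str n) → K A → K B →
  ∃ λ (C : Str n) → K C ×
    (∀ (χ : Subset (size C) → Fin k) →
      ∃ λ (T : Subset (size C)) → IsCopy B C T ×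
        ∃ λ (c : Fin k) → ∀ (S : Subset (size C)) → S ⊆ T → IsCopy A C S → χ S ≡ c)

{-# OPTIONS --safe #-}
module Submission where

-- Let C_N be the structure with part P_i = { (i , X) : X ⊆ N }, each part
-- ordered lexicographically, in which for i < j there is an edge from (i , X)
-- to (j , Y) if X meets Y, and from (j , Y) to (i , X) otherwise.  A
-- k-parameter word of length N over the alphabet {0} sends subsets of k to
-- subsets of N and so induces an embedding C_k → C_N.  Coding every vertex by a
-- private element together with one element for each edge at it that agrees with
-- the order embeds A in some C_k and B in some C_m in such a way that every
-- embedding A → B is induced by a parameter word.  The theorem thus reduces to the Graham–Rothschild theorem.
-- The latter is proved by induction on the number of parameters: the colour of
-- a word is first made to depend only on the segment before its first
-- parameter, and these segments are handled with Shelah's argument for the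
-- Hales–Jewett theorem, which merges two letters of the alphabet at a time.

open import Defs
open import Data.Bool using (Bool; true; false; not; _∧_; _∨_)
open import Data.Bool.Properties using (not-involutive; ∧-conicalˡ; ∧-conicalʳ; ∧-zeroʳ; ∨-identityʳ; ∨-zeroʳ)
open import Data.Fin using (Fin; zero; suc; toℕ; fromℕ<; combine; remQuot; punchOut; funToFin; finToFun) renaming (_<_ to _<ᶠ_; _≤_ to _≤ᶠ_)
open import Data.Fin.Properties using (pigeonhole; toℕ-fromℕ<; toℕ≤pred[n]; finToFun-funToFin; remQuot-combine; combine-remQuot; combine-monoˡ-<; toℕ-combine; any?; <-cmp; <-asym; <-irrefl; injective⇒≤; punchOut-injective; _≟_)
open import Data.Fin.Subset using (Subset; _∈_; _⊆_; ⊥; ∣_∣)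
open import Data.Fin.Subset.Properties using (p⊂q⇒∣p∣<∣q∣; ∣⊤∣≡n; ∈⊤; ⊆-antisym)
open import Data.Maybe using (Maybe; just; nothing; maybe)
open import Data.Nat using (ℕ; zero; suc; _+_; _*_; _^_; _≤_; _<_; z≤n; s≤s; s≤s⁻¹)
open import Data.Nat.Properties as ℕ using (≤-refl; ≤-trans; ≤-reflexive; n<1+n; m≤n⇒∃[o]m+o≡n; +-suc)
open import Data.Product using (∃; Σ; _×_; _,_; proj₁; proj₂)
open import Data.Sum using (_⊎_; inj₁; inj₂; [_,_]′)
open import Data.Vec using (Vec; []; _∷_; lookup; _[_]≔_; replicate; tabulate) renaming (sum to sumᵛ)
open import Data.Vec.Functional using () renaming (_∷_ to _▸_)
open import Data.Vec.Properties using (lookup∘updateAt; lookup∘updateAt′; lookup-replicate; lookup∘tabulate; []=⇒lookup; lookup⇒[]=)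
open import Function using (id; _∘_)
open import Function.Definitions using (Injective)
open import Relation.Binary using (Tri; tri<; tri≈; tri>)
open import Relation.Nullary using (Dec; does; yes; no; contradiction)
open import Relation.Nullary.Decidable using (dec-true; dec-false)
open import Relation.Binary.PropositionalEquality

-- Parameter words

-- Words of length N over a letters and k parameters, whose first occurrences
-- come in increasing order.  After its first occurrence a parameter is treated
-- as an additional letter, with index zero.
data W (a : ℕ) : ℕ → ℕ → Set where
  []     : W a 0 0
  letter : ∀ {k N} → Fin a → W a k N → W a k (suc N)
  new    : ∀ {k N} → W (suc a) k N → W a (suc k) (suc N)

lift : ∀ {a b} → (Fin a → Fin b) → Fin (suc a) → Fin (suc b)
lift ρ = zero ▸ (suc ∘ ρ)

-- Substitutes `g` for the parameters of `F`. The map `ρ` gives the values of the letters of `F`; it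
-- has to be arbitrary because each `new` turns a parameter into a letter whose value is read off
-- from `g`.
comp : ∀ {a b k m N} → (Fin a → Fin b) → W a m N → W b k m → W b k N
comp ρ []           g            = g
comp ρ (letter x F) g            = letter (ρ x) (comp ρ F g)
comp ρ (new F)      (letter y g) = letter y (comp (y ▸ ρ) F g)
comp ρ (new F)      (new g)      = new (comp (lift ρ) F g)

-- With `τ = suc`, places a word behind a parameter that has already occurred, without using that
-- parameter.
rename : ∀ {a b k N} → (Fin a → Fin b) → W a k N → W b k N
rename τ []           = []
rename τ (letter x F) = letter (τ x) (rename τ F)
rename τ (new F)      = new (rename (lift τ) F)

▸-cong : ∀ {a} {B : Set} {x y : B} {ρ σ : Fin a → B} → x ≡ y → ρ ≗ σ → (x ▸ ρ) ≗ (y ▸ σ)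
▸-cong x≡y ρ≗σ zero    = x≡y
▸-cong x≡y ρ≗σ (suc i) = ρ≗σ i

∘-▸ : ∀ {a} {B C : Set} (h : B → C) (x : B) (ρ : Fin a → B) → h ∘ (x ▸ ρ) ≗ (h x ▸ (h ∘ ρ))
∘-▸ h x ρ zero    = refl
∘-▸ h x ρ (suc i) = refl

▸-lift : ∀ {a b} {C : Set} (x : C) (ρ : Fin b → C) (σ : Fin a → Fin b) →
         (x ▸ ρ) ∘ lift σ ≗ (x ▸ (ρ ∘ σ))
▸-lift x ρ σ zero    = refl
▸-lift x ρ σ (suc i) = refl

lift-∘ : ∀ {a b c} (ρ : Fin b → Fin c) (σ : Fin a → Fin b) → lift ρ ∘ lift σ ≗ lift (ρ ∘ σ)
lift-∘ ρ σ zero    = refl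
lift-∘ ρ σ (suc i) = refl

comp-cong : ∀ {a b k m N} {ρ σ : Fin a → Fin b} → ρ ≗ σ →
            (F : W a m N) (g : W b k m) → comp ρ F g ≡ comp σ F g
comp-cong e []           g            = refl
comp-cong e (letter x F) g            = cong₂ letter (e x) (comp-cong e F g)
comp-cong e (new F)      (letter y g) = cong (letter y) (comp-cong (▸-cong refl e) F g)
comp-cong e (new F)      (new g)      = cong new (comp-cong (▸-cong refl (cong suc ∘ e)) F g)

comp-assoc : ∀ {a b c l k m N} (ρ : Fin b → Fin c) (σ : Fin a → Fin b)
             (F : W a m N) (G : W b k m) (H : W c l k) →
             comp ρ (comp σ F G) H ≡ comp (ρ ∘ σ) F (comp ρ G H)
comp-assoc ρ σ []           G            H            = refl
comp-assoc ρ σ (letter x F) G            H            = cong (letter _) (comp-assoc ρ σ F G H)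
comp-assoc ρ σ (new F)      (letter y G) H            = cong (letter _)
  (trans (comp-assoc ρ (y ▸ σ) F G H) (comp-cong (∘-▸ ρ y σ) F _))
comp-assoc ρ σ (new F)      (new G)      (letter z H) = cong (letter z)
  (trans (comp-assoc (z ▸ ρ) (lift σ) F G H) (comp-cong (▸-lift z ρ σ) F _))
comp-assoc ρ σ (new F)      (new G)      (new H)      = cong new
  (trans (comp-assoc (lift ρ) (lift σ) F G H) (comp-cong (lift-∘ ρ σ) F _))

comp-rename : ∀ {a b c k m N} (ρ : Fin b → Fin c) (τ : Fin a → Fin b)
              (F : W a m N) (g : W c k m) → comp ρ (rename τ F) g ≡ comp (ρ ∘ τ) F g
comp-rename ρ τ []           g            = refl
comp-rename ρ τ (letter x F) g            = cong (letter _) (comp-rename ρ τ F g)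
comp-rename ρ τ (new F)      (letter y g) = cong (letter y)
  (trans (comp-rename (y ▸ ρ) (lift τ) F g) (comp-cong (▸-lift y ρ τ) F g))
comp-rename ρ τ (new F)      (new g)      = cong new
  (trans (comp-rename (lift ρ) (lift τ) F g) (comp-cong (lift-∘ ρ τ) F g))

-- Initial segments of words

-- The letters before the first parameter. At length 0 `stop` is the end of the word; at positive
-- length it marks the place of a parameter.
data L (a : ℕ) : ℕ → Set where
  stop : ∀ {N} → L a N
  _∷_  : ∀ {N} → Fin a → L a N → L a (suc N)

full : ∀ {a N} → L a N → Bool
full {N = zero}  stop = true
full {N = suc N} stop = false
full (x ∷ p)          = full p

pre : ∀ {a k N} → W a k N → L a N
pre []           = stop
pre (letter x g) = x ∷ pre g
pre (new g)      = stop

-- The action on initial segments that makes pre equivariant (pre-comp):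
-- a segment that stops is continued up to the next unused parameter of F.
act : ∀ {a b m N} → (Fin a → Fin b) → W a m N → L b m → L b N
act ρ []           p       = p
act ρ (letter x F) p       = ρ x ∷ act ρ F p
act ρ (new F)      stop    = stop
act ρ (new F)      (y ∷ p) = y ∷ act (y ▸ ρ) F p

mapL : ∀ {a b N} → (Fin a → Fin b) → L a N → L b N
mapL h stop    = stop
mapL h (x ∷ p) = h x ∷ mapL h p

full-mapL : ∀ {a b N} (h : Fin a → Fin b) (p : L a N) → full (mapL h p) ≡ full p
full-mapL {N = zero}  h stop    = refl
full-mapL {N = suc N} h stop    = refl
full-mapL             h (x ∷ p) = full-mapL h p

full-pre-zero : ∀ {a N} (g : W a 0 N) → full (pre g) ≡ true
full-pre-zero []           = refl
full-pre-zero (letter x g) = full-pre-zero g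

full-pre-suc : ∀ {a k N} (g : W a (suc k) N) → full (pre g) ≡ false
full-pre-suc (letter x g) = full-pre-suc g
full-pre-suc (new g)      = refl

pre-comp : ∀ {a b k m N} (ρ : Fin a → Fin b) (F : W a m N) (g : W b k m) →
           pre (comp ρ F g) ≡ act ρ F (pre g)
pre-comp ρ []           g            = refl
pre-comp ρ (letter x F) g            = cong (_ ∷_) (pre-comp ρ F g)
pre-comp ρ (new F)      (letter y g) = cong (y ∷_) (pre-comp (y ▸ ρ) F g)
pre-comp ρ (new F)      (new g)      = refl

act-cong : ∀ {a b m N} {ρ σ : Fin a → Fin b} → ρ ≗ σ →
           (F : W a m N) (p : L b m) → act ρ F p ≡ act σ F p
act-cong e []           p       = refl
act-cong e (letter x F) p       = cong₂ _∷_ (e x) (act-cong e F p)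
act-cong e (new F)      stop    = refl
act-cong e (new F)      (y ∷ p) = cong (y ∷_) (act-cong (▸-cong refl e) F p)

act-comp : ∀ {a b c k m N} (ρ : Fin b → Fin c) (σ : Fin a → Fin b)
           (F : W a m N) (G : W b k m) (p : L c k) →
           act ρ (comp σ F G) p ≡ act (ρ ∘ σ) F (act ρ G p)
act-comp ρ σ []           G            p       = refl
act-comp ρ σ (letter x F) G            p       = cong (_ ∷_) (act-comp ρ σ F G p)
act-comp ρ σ (new F)      (letter y G) p       = cong (_ ∷_)
  (trans (act-comp ρ (y ▸ σ) F G p) (act-cong (∘-▸ ρ y σ) F _))
act-comp ρ σ (new F)      (new G)      stop    = refl
act-comp ρ σ (new F)      (new G)      (z ∷ p) = cong (z ∷_)
  (trans (act-comp (z ▸ ρ) (lift σ) F G p) (act-cong (▸-lift z ρ σ) F _))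

act-rename : ∀ {a b c m N} (ρ : Fin b → Fin c) (τ : Fin a → Fin b)
             (F : W a m N) (p : L c m) → act ρ (rename τ F) p ≡ act (ρ ∘ τ) F p
act-rename ρ τ []           p       = refl
act-rename ρ τ (letter x F) p       = cong (_ ∷_) (act-rename ρ τ F p)
act-rename ρ τ (new F)      stop    = refl
act-rename ρ τ (new F)      (y ∷ p) = cong (y ∷_)
  (trans (act-rename (y ▸ ρ) (lift τ) F p) (act-cong (▸-lift y ρ τ) F p))

mapL-act : ∀ {a b c m N} (h : Fin b → Fin c) (ρ : Fin a → Fin b) (F : W a m N) (p : L b m) →
           mapL h (act ρ F p) ≡ act (h ∘ ρ) F (mapL h p)
mapL-act h ρ []           p       = refl
mapL-act h ρ (letter x F) p       = cong (_ ∷_) (mapL-act h ρ F p)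
mapL-act h ρ (new F)      stop    = refl
mapL-act h ρ (new F)      (y ∷ p) = cong (_ ∷_)
  (trans (mapL-act h (y ▸ ρ) F p) (act-cong (∘-▸ h y ρ) F _))

-- Encoding colourings of initial segments by numbers

∣L∣ : ℕ → ℕ → ℕ
∣L∣ a zero    = 1
∣L∣ a (suc N) = suc (a * ∣L∣ a N)

enumL : ∀ a N → Fin (∣L∣ a N) → L a N
enumL a zero    _       = stop
enumL a (suc N) zero    = stop
enumL a (suc N) (suc i) = proj₁ (remQuot {a} (∣L∣ a N) i) ∷ enumL a N (proj₂ (remQuot {a} (∣L∣ a N) i))

indexL : ∀ {a N} → L a N → Fin (∣L∣ a N)
indexL {N = zero}  stop    = zero
indexL {N = suc N} stop    = zero
indexL             (x ∷ p) = suc (combine x (indexL p))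

enumL-indexL : ∀ {a N} (p : L a N) → enumL a N (indexL p) ≡ p
enumL-indexL {N = zero}          stop    = refl
enumL-indexL {N = suc N}         stop    = refl
enumL-indexL {a} {N = suc N} (x ∷ p) = trans
  (cong (λ q → proj₁ q ∷ enumL a N (proj₂ q)) (remQuot-combine x (indexL p)))
  (cong (x ∷_) (enumL-indexL p))

code : ∀ {a N r} → (L a N → Fin r) → Fin (r ^ ∣L∣ a N)
code {a} {N} φ = funToFin (φ ∘ enumL a N)

-- The code records the values on the range of `enumL`, which contains every segment `p` because of
-- `indexL p`.
code-injective : ∀ {a N r} (φ ψ : L a N → Fin r) → code φ ≡ code ψ → φ ≗ ψ
code-injective {a} {N} φ ψ eq p = begin
  φ p                                    ≡⟨ cong φ (enumL-indexL p) ⟨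
  φ (enumL a N (indexL p))               ≡⟨ finToFun-funToFin (φ ∘ enumL a N) (indexL p) ⟨
  finToFun (code φ) (indexL p)           ≡⟨ cong (λ c → finToFun c (indexL p)) eq ⟩
  finToFun (code ψ) (indexL p)           ≡⟨ finToFun-funToFin (ψ ∘ enumL a N) (indexL p) ⟩
  ψ (enumL a N (indexL p))               ≡⟨ cong ψ (enumL-indexL p) ⟩
  ψ p                                    ∎
  where open ≡-Reasoning

-- Shelah's insensitivity argument

-- A first block that stops early ends the whole segment, so the second block is discarded.
_⧺_ : ∀ {a n N} → L a n → L a N → L a (n + N)
_⧺_ {n = zero}  stop p = p
_⧺_ {n = suc n} stop p = stop
(x ∷ u) ⧺ p            = x ∷ (u ⧺ p)

one : ∀ {a} → Fin (suc (suc a))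
one = suc zero

-- The word `x ^ d 1 ^ (n - d)`, cut off at length `n`.
ray : ∀ {a} n → ℕ → Fin (suc (suc a)) → L (suc (suc a)) n
ray zero    d       x = stop
ray (suc n) zero    x = one ∷ ray n zero x
ray (suc n) (suc d) x = x ∷ ray n d x

-- Here `zero` is the parameter opened before the ray, `suc one` is the old letter `one`, and
-- `rename suc` keeps `F` free of that parameter.
rayW : ∀ {a m N} n → ℕ → W (suc (suc a)) m N → W (suc (suc (suc a))) m (n + N)
rayW zero    d       F = rename suc F
rayW (suc n) zero    F = letter (suc one) (rayW n zero F)
rayW (suc n) (suc d) F = letter zero (rayW n d F)

-- For x = 0 and for x = 1 these are words of the form 0 ^ i 1 ^ (n - i); the
-- pigeonhole principle for these n + 1 words yields a line on which 0 and 1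
-- are not distinguished.
line : ∀ {a n} → Fin n → ℕ → Fin (suc (suc a)) → L (suc (suc a)) n
line {n = suc n} zero    d x = x ∷ ray n d x
line             (suc j) d x = zero ∷ line j d x

lineW : ∀ {a m N n} → Fin n → ℕ → W (suc (suc a)) m N → W (suc (suc a)) (suc m) (n + N)
lineW {n = suc n} zero    d F = new (rayW n d F)
lineW             (suc j) d F = letter zero (lineW j d F)

act-rayW : ∀ {a m N} n d (F : W (suc (suc a)) m N) x p →
           act (x ▸ id) (rayW n d F) p ≡ ray n d x ⧺ act id F p
act-rayW zero    d       F x p = act-rename (x ▸ id) suc F p
act-rayW (suc n) zero    F x p = cong (one ∷_) (act-rayW n zero F x p)
act-rayW (suc n) (suc d) F x p = cong (x ∷_) (act-rayW n d F x p)

act-lineW : ∀ {a m N n} (j : Fin n) d (F : W (suc (suc a)) m N) x p →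
            act id (lineW j d F) (x ∷ p) ≡ line j d x ⧺ act id F p
act-lineW {n = suc n} zero    d F x p = cong (x ∷_) (act-rayW n d F x p)
act-lineW             (suc j) d F x p = cong (zero ∷_) (act-lineW j d F x p)

ray-one : ∀ {a} n d (x : Fin (suc (suc a))) → ray n d one ≡ ray n zero x
ray-one zero    d       x = refl
ray-one (suc n) zero    x = cong (one ∷_) (ray-one n zero x)
ray-one (suc n) (suc d) x = cong (one ∷_) (ray-one n d x)

line-zero : ∀ {a n} (j : Fin n) d → line {a} j d zero ≡ ray n (suc (toℕ j + d)) zero
line-zero zero    d = refl
line-zero (suc j) d = cong (zero ∷_) (line-zero j d)

line-one : ∀ {a n} (j : Fin n) d → line {a} j d one ≡ ray n (toℕ j) zero
line-one {n = suc n} zero    d = cong (one ∷_) (ray-one n d zero)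
line-one             (suc j) d = cong (zero ∷_) (line-one j d)

down : ∀ {a} → Fin (suc (suc a)) → Fin (suc a)
down zero    = zero
down (suc x) = x

merge : ∀ {a} → Fin (suc (suc a)) → Fin (suc (suc a))
merge = suc ∘ down

-- Induction on `m`: a block of `n` positions for the new parameter is put in front of `N` positions
-- for the others. Since `n` is the number of colourings of `L A m`, two of the `n + 1` words
-- `0 ^ i 1 ^ (n - i)` induce the same colouring of the segments of `F`; `N` is chosen after `n`.
insensitive : ∀ a m r → ∃ λ N → ∀ (χ : L (suc (suc a)) N → Fin r) →
              ∃ λ (F : W (suc (suc a)) m N) →
              ∀ p → χ (act id F p) ≡ χ (act id F (mapL merge p))
insensitive a zero    r = 0 , λ χ → [] , λ { stop → refl }
insensitive a (suc m) r = n + N , step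
  where
  A = suc (suc a)
  n = r ^ ∣L∣ A m
  rest = insensitive a m (r ^ ∣L∣ A n)
  N = proj₁ rest
  step : (χ : L A (n + N) → Fin r) → ∃ λ (F : W A (suc m) (n + N)) →
         ∀ p → χ (act id F p) ≡ χ (act id F (mapL merge p))
  -- The colour of `p` is the whole function of `u` given by `χ (u ⧺ p)`, so `F` is insensitive for
  -- all first blocks at once.
  step χ with proj₂ rest (λ p → code (λ u → χ (u ⧺ p)))
  ... | F , F-ins with pigeonhole (n<1+n n) (λ i → code (λ p → χ (ray n (toℕ i) zero ⧺ act id F p)))
  ... | i , i′ , i<i′ , same with m≤n⇒∃[o]m+o≡n i<i′
  -- With `j = i` and `d = i′ - i - 1`, the line takes the two words found by pigeonhole as its
  -- values at `zero` and `one`.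
  ... | d , eq = lineW j d F , ins
    where
    i<n : toℕ i < n
    i<n = ≤-trans i<i′ (toℕ≤pred[n] i′)
    j = fromℕ< i<n
    line₀ : line j d zero ≡ ray n (toℕ i′) zero
    line₀ = trans (line-zero j d)
      (cong (λ t → ray n t zero) (trans (cong (λ t → suc (t + d)) (toℕ-fromℕ< i<n)) eq))
    line₁ : line j d one ≡ ray n (toℕ i) zero
    line₁ = trans (line-one j d) (cong (λ t → ray n t zero) (toℕ-fromℕ< i<n))
    first : ∀ x p → χ (line j d x ⧺ act id F p) ≡ χ (line j d (merge x) ⧺ act id F p)
    first (suc x) p = refl
    first zero    p = begin
      χ (line j d zero ⧺ act id F p)           ≡⟨ cong (λ u → χ (u ⧺ act id F p)) line₀ ⟩
      χ (ray n (toℕ i′) zero ⧺ act id F p)     ≡⟨ code-injective _ _ same p ⟨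
      χ (ray n (toℕ i) zero ⧺ act id F p)      ≡⟨ cong (λ u → χ (u ⧺ act id F p)) line₁ ⟨
      χ (line j d one ⧺ act id F p)            ∎
      where open ≡-Reasoning
    ins : ∀ p → χ (act id (lineW j d F) p) ≡ χ (act id (lineW j d F) (mapL merge p))
    ins stop    = refl
    ins (x ∷ p) = begin
      χ (act id (lineW j d F) (x ∷ p))                    ≡⟨ cong χ (act-lineW j d F x p) ⟩
      χ (line j d x ⧺ act id F p)                         ≡⟨ code-injective (λ u → χ (u ⧺ act id F p))
                                                                            (λ u → χ (u ⧺ act id F (mapL merge p)))
                                                                            (F-ins p) (line j d x) ⟩
      χ (line j d x ⧺ act id F (mapL merge p))            ≡⟨ first x (mapL merge p) ⟩
      χ (line j d (merge x) ⧺ act id F (mapL merge p))    ≡⟨ cong χ (act-lineW j d F (merge x) (mapL merge p)) ⟨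
      χ (act id (lineW j d F) (merge x ∷ mapL merge p))   ∎
      where open ≡-Reasoning

-- Colourings of initial segments

zeros : ∀ {a} N → L (suc a) N
zeros zero    = stop
zeros (suc N) = zero ∷ zeros N

full⇒zeros : ∀ {N} (p : L 1 N) → full p ≡ true → p ≡ zeros N
full⇒zeros {N = zero}  stop       _  = refl
full⇒zeros {N = suc N} stop       ()
full⇒zeros             (zero ∷ p) eq = cong (zero ∷_) (full⇒zeros p eq)

blank : ∀ {a} N → W (suc a) 0 N
blank zero    = []
blank (suc N) = letter zero (blank N)

full-zero : ∀ {a} (p : L a 0) → full p ≡ true
full-zero stop = refl

sum-decrease : ∀ {r} (d : Vec ℕ r) c {e} → lookup d c ≡ suc e → sumᵛ d ≡ suc (sumᵛ (d [ c ]≔ e))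
sum-decrease (x ∷ d) zero    refl = refl
sum-decrease (x ∷ d) (suc c) eq   =
  trans (cong (x +_) (sum-decrease d c eq)) (+-suc x _)

sum≤0⇒lookup≡0 : ∀ {r} (d : Vec ℕ r) c → sumᵛ d ≤ 0 → lookup d c ≡ 0
sum≤0⇒lookup≡0 (zero ∷ d) zero    _ = refl
sum≤0⇒lookup≡0 (zero ∷ d) (suc c) h = sum≤0⇒lookup≡0 d c h

-- d c is the number of parameters that still have to be placed at positions
-- of colour c.
distribute : ∀ {r} N (d : Vec ℕ r) → sumᵛ d ≤ N → (χ : L 1 N → Fin r) → Fin r →
             ∃ λ c → ∃ λ m → lookup d c ≡ m × Σ (W 1 m N) λ F →
             ∀ p → full p ≡ false → χ (act id F p) ≡ c
distribute zero    d h χ c₀ = c₀ , 0 , sum≤0⇒lookup≡0 d c₀ h , [] ,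
  λ p np → contradiction (trans (sym np) (full-zero p)) λ ()
distribute (suc N) d h χ c₀ with lookup d (χ stop) in eq
-- This colour has received all its parameters, so the rest is blank and 0 parameters remain. The
-- condition is vacuous, as the only segment of length 0 is full.
... | zero = χ stop , 0 , eq , blank (suc N) ,
  λ p np → contradiction (trans (sym np) (full-zero p)) λ ()
... | suc e with distribute N (d [ χ stop ]≔ e)
                   (s≤s⁻¹ (≤-trans (≤-reflexive (sym (sum-decrease d (χ stop) eq))) h))
                   (λ p → χ (zero ∷ p)) c₀
... | c , m , dc≡m , F , mono with c ≟ χ stop
-- The winning colour `c` is known only after the recursion; the present position becomes a
-- parameter exactly if its colour is `c`.
... | yes refl = c , suc m ,
      trans eq (cong suc (trans (sym (lookup∘updateAt c d)) dc≡m)) ,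
      new (rename suc F) , λ
        { stop       _  → refl
        ; (zero ∷ p) np → trans (cong (λ q → χ (zero ∷ q)) (act-rename (zero ▸ id) suc F p)) (mono p np)
        }
... | no c≢ = c , m , trans (sym (lookup∘updateAt′ c (χ stop) c≢ d)) dc≡m ,
      letter zero F , mono

-- Induction on the alphabet. Over one letter a segment is given by where it stops: among `r * m`
-- positions `distribute` finds `m` of one colour, and just one segment is full. Otherwise
-- `insensitive` makes `zero` and `one` interchangeable, and the induction hypothesis is applied to
-- the letters other than `zero`.
segments : ∀ a m r → ∃ λ N → ∀ (χ : L (suc a) N → Fin r) → Fin r →
           ∃ λ (F : W (suc a) m N) → ∃ λ (c : Bool → Fin r) →
           ∀ p → χ (act id F p) ≡ c (full p)
segments zero m r = sumᵛ (replicate r m) , step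
  where
  step : (χ : L 1 (sumᵛ (replicate r m)) → Fin r) → Fin r →
         ∃ λ (F : W 1 m _) → ∃ λ (c : Bool → Fin r) → ∀ p → χ (act id F p) ≡ c (full p)
  step χ c₀ with distribute _ (replicate r m) ≤-refl χ c₀
  ... | c , m′ , eq , F , mono with trans (sym (lookup-replicate c m)) eq
  ... | refl = F , colour , proof
    where
    colour : Bool → Fin r
    colour true  = χ (act id F (zeros m))
    colour false = c
    proof : ∀ p → χ (act id F p) ≡ colour (full p)
    proof p with full p in fp
    ... | true  = cong (χ ∘ act id F) (full⇒zeros p fp)
    ... | false = mono p fp
segments (suc a) m r with segments a m r
... | M , seg with insensitive a M r
... | N , ins = N , step
  where
  step : (χ : L (suc (suc a)) N → Fin r) → Fin r →
         ∃ λ (F : W (suc (suc a)) m N) → ∃ λ (c : Bool → Fin r) →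
         ∀ p → χ (act id F p) ≡ c (full p)
  step χ c₀ with ins χ
  ... | F , F-ins with seg (λ p → χ (act id F (mapL suc p))) c₀
  ... | G , c , mono = comp id F (rename suc G) , c , λ p → begin
      χ (act id (comp id F (rename suc G)) p)
        ≡⟨ cong χ (act-comp id id F (rename suc G) p) ⟩
      χ (act id F (act id (rename suc G) p))
        ≡⟨ cong (χ ∘ act id F) (act-rename id suc G p) ⟩
      χ (act id F (act suc G p))
        -- `G` is renamed to avoid `zero`, so only `p` contributes it; after merging, the segment
        -- comes from the smaller alphabet.
        ≡⟨ F-ins _ ⟩
      χ (act id F (mapL merge (act suc G p)))
        ≡⟨ cong (χ ∘ act id F) (mapL-act merge suc G p) ⟩
      χ (act id F (act suc G (mapL merge p)))
        ≡⟨ cong (λ q → χ (act id F (act suc G q))) (mapL-∘ p) ⟩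
      χ (act id F (act suc G (mapL suc (mapL down p))))
        ≡⟨ cong (χ ∘ act id F) (mapL-act suc id G (mapL down p)) ⟨
      χ (act id F (mapL suc (act id G (mapL down p))))
        ≡⟨ mono (mapL down p) ⟩
      c (full (mapL down p))
        ≡⟨ cong c (full-mapL down p) ⟩
      c (full p) ∎
    where
    open ≡-Reasoning
    mapL-∘ : ∀ {N} (p : L (suc (suc a)) N) → mapL merge p ≡ mapL suc (mapL down p)
    mapL-∘ stop    = refl
    mapL-∘ (x ∷ p) = cong (_ ∷_) (mapL-∘ p)

-- The Graham–Rothschild theorem

-- The additional colour is a default for the case that `W a k N` is empty and `χ` yields no colour.
GrahamRothschild : ℕ → ℕ → Set
GrahamRothschild a k = ∀ m r → ∃ λ N → ∀ (χ : W a k N → Fin r) → Fin r →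
  ∃ λ (F : W a m N) → ∃ λ (c : Fin r) → ∀ (g : W a k m) → χ (comp id F g) ≡ c

-- Carries a colouring of parameterless words over to segments. The padding after an early stop is a
-- default value.
fill : ∀ {a N} → L (suc a) N → W (suc a) 0 N
fill {N = N} stop    = blank N
fill         (x ∷ p) = letter x (fill p)

fill-pre : ∀ {a N} (g : W (suc a) 0 N) → fill (pre g) ≡ g
fill-pre []           = refl
fill-pre (letter x g) = cong (letter x) (fill-pre g)

-- Induction on `m`, with a parameter at the first position. Words that keep it have the form
-- `new g`, where `g` has `k` parameters over one more letter, and `gr` gives them one colour. Words
-- that replace it by a letter are left to the induction hypothesis.
prefixDetermined : ∀ a k → GrahamRothschild (suc a) k → ∀ m r →
  ∃ λ N → ∀ (χ : W a (suc k) N → Fin r) → Fin r →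
  ∃ λ (F : W a m N) → ∃ λ (c : L a m → Fin r) → ∀ g → χ (comp id F g) ≡ c (pre g)
prefixDetermined a k gr zero    r = 0 , λ χ c₀ → [] , (λ _ → c₀) , λ ()
prefixDetermined a k gr (suc m) r with prefixDetermined a k gr m (r ^ a)
... | M , later with gr M r
... | N , first = suc N , step
  where
  step : (χ : W a (suc k) (suc N) → Fin r) → Fin r →
         ∃ λ (F : W a (suc m) (suc N)) → ∃ λ (c : L a (suc m) → Fin r) →
         ∀ g → χ (comp id F g) ≡ c (pre g)
  step χ c₀ with first (χ ∘ new) c₀
  ... | F , c₁ , F-mono
    -- One colour for each value `x` of the first parameter, hence `r ^ a` colours; all values are
    -- treated simultaneously.
    with later (λ g → funToFin (λ x → χ (letter x (comp (x ▸ id) F g)))) (funToFin {a} (λ _ → c₀))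
  -- `F` may use the first parameter as a letter, while `rename suc` keeps `G` from using it; so `G`
  -- does not change with `x`.
  ... | G , c₂ , G-mono = new (comp id F (rename suc G)) , c , mono
    where
    c : L a (suc m) → Fin r
    c stop    = c₁
    c (x ∷ p) = finToFun (c₂ p) x
    lift-id : ∀ {b} → lift {b} id ≗ id
    lift-id zero    = refl
    lift-id (suc i) = refl
    open ≡-Reasoning
    mono : ∀ g → χ (comp id (new (comp id F (rename suc G))) g) ≡ c (pre g)
    mono (new g) = begin
      χ (new (comp (lift id) (comp id F (rename suc G)) g))
        ≡⟨ cong (χ ∘ new) (comp-cong lift-id (comp id F (rename suc G)) g) ⟩
      χ (new (comp id (comp id F (rename suc G)) g))
        ≡⟨ cong (χ ∘ new) (comp-assoc id id F (rename suc G) g) ⟩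
      χ (new (comp id F (comp id (rename suc G) g)))
        ≡⟨ F-mono _ ⟩
      c₁ ∎
    mono (letter x g) = begin
      χ (letter x (comp (x ▸ id) (comp id F (rename suc G)) g))
        ≡⟨ cong (χ ∘ letter x) (comp-assoc (x ▸ id) id F (rename suc G) g) ⟩
      χ (letter x (comp (x ▸ id) F (comp (x ▸ id) (rename suc G) g)))
        ≡⟨ cong (λ h → χ (letter x (comp (x ▸ id) F h))) (comp-rename (x ▸ id) suc G g) ⟩
      χ (letter x (comp (x ▸ id) F (comp id G g)))
        ≡⟨ finToFun-funToFin (λ y → χ (letter y (comp (y ▸ id) F (comp id G g)))) x ⟨
      finToFun (funToFin (λ y → χ (letter y (comp (y ▸ id) F (comp id G g))))) x
        ≡⟨ cong (λ t → finToFun t x) (G-mono g) ⟩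
      finToFun (c₂ (pre g)) x ∎

-- Induction on `k` for all alphabets at once, since `prefixDetermined` needs `k` parameters over a
-- larger alphabet. Segments of parameterless words are always full and those of other words never,
-- so `segments` leaves one colour in either case.
grahamRothschild : ∀ k a → GrahamRothschild (suc a) k
grahamRothschild zero a m r with segments a m r
... | N , seg = N , λ χ c₀ → let F , c , mono = seg (χ ∘ fill) c₀ in
      F , c true , λ g → begin
        χ (comp id F g)              ≡⟨ cong χ (fill-pre (comp id F g)) ⟨
        χ (fill (pre (comp id F g))) ≡⟨ cong (χ ∘ fill) (pre-comp id F g) ⟩
        χ (fill (act id F (pre g)))  ≡⟨ mono (pre g) ⟩
        c (full (pre g))             ≡⟨ cong c (full-pre-zero g) ⟩
        c true                       ∎
  where open ≡-Reasoning
grahamRothschild (suc k) a m r with segments a m r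
... | M , seg with prefixDetermined (suc a) k (grahamRothschild k (suc a)) M r
... | N , det = N , λ χ c₀ → let F , c₁ , F-mono = det χ c₀
                                 G , c₂ , G-mono = seg c₁ c₀ in
      comp id F G , c₂ false , λ g → begin
        χ (comp id (comp id F G) g)  ≡⟨ cong χ (comp-assoc id id F G g) ⟩
        χ (comp id F (comp id G g))  ≡⟨ F-mono (comp id G g) ⟩
        c₁ (pre (comp id G g))       ≡⟨ cong c₁ (pre-comp id G g) ⟩
        c₁ (act id G (pre g))        ≡⟨ G-mono (pre g) ⟩
        c₂ (full (pre g))            ≡⟨ cong c₂ (full-pre-suc g) ⟩
        c₂ false                     ∎
  where open ≡-Reasoning

-- Parameter words from functions on positions

tab : ∀ {b N} → (Fin N → Fin b) → W b 0 N
tab {N = zero}  σ = []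
tab {N = suc N} σ = letter (σ zero) (tab (σ ∘ suc))

tab-cong : ∀ {b N} {σ τ : Fin N → Fin b} → σ ≗ τ → tab σ ≡ tab τ
tab-cong {N = zero}  e = refl
tab-cong {N = suc N} e = cong₂ letter (e zero) (tab-cong (e ∘ suc))

-- Once parameter `zero` has occurred it counts as the letter `zero`, as in the constructor `new`.
shift : ∀ {a k} → Fin a ⊎ Fin (suc k) → Fin (suc a) ⊎ Fin k
shift (inj₁ x)       = inj₁ (suc x)
shift (inj₂ zero)    = inj₁ zero
shift (inj₂ (suc t)) = inj₂ t

shift-inj₂ : ∀ {a k} (q : Fin a ⊎ Fin (suc k)) {t} → shift q ≡ inj₂ t → q ≡ inj₂ (suc t)
shift-inj₂ (inj₂ (suc t)) refl = refl

shift-eval : ∀ {a b k} (ρ : Fin a → Fin b) (σ : Fin (suc k) → Fin b) q →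
             [ σ zero ▸ ρ , σ ∘ suc ]′ (shift q) ≡ [ ρ , σ ]′ q
shift-eval ρ σ (inj₁ x)       = refl
shift-eval ρ σ (inj₂ zero)    = refl
shift-eval ρ σ (inj₂ (suc t)) = refl

positive : ∀ {m} (u : Fin (suc m)) → u ≢ zero → ∃ λ v → u ≡ suc v
positive zero    u≢0 = contradiction refl u≢0
positive (suc v) _   = v , refl

-- The positions are read from left to right: `first` certifies that all parameters occur and do so
-- in increasing order, which is what `W` builds into its type.
wordOf : ∀ {a k m} (p : Fin m → Fin a ⊎ Fin k) (first : Fin k → Fin m) →
         (∀ t → p (first t) ≡ inj₂ t) →
         (∀ {t t′} → t <ᶠ t′ → first t <ᶠ first t′) →
         (∀ u t → p u ≡ inj₂ t → first t ≤ᶠ u) →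
         ∃ λ (g : W a k m) → ∀ {b} (ρ : Fin a → Fin b) (σ : Fin k → Fin b) →
           comp ρ g (tab σ) ≡ tab ([ ρ , σ ]′ ∘ p)
wordOf {k = zero}  {zero} p first occ mono least = [] , λ _ _ → refl
wordOf {k = suc k} {zero} p first occ mono least = contradiction (first zero) λ ()
wordOf {a} {k} {suc m} p first occ mono least with p zero in p₀
... | inj₁ x = letter x (proj₁ rest) , λ ρ σ →
        cong (letter (ρ x)) (proj₂ rest ρ σ)
  where
  later : ∀ t → ∃ λ v → first t ≡ suc v
  later t = positive (first t) λ e →
    contradiction (trans (sym (occ t)) (trans (cong p e) p₀)) λ ()
  rest = wordOf (p ∘ suc) (proj₁ ∘ later)
    (λ t → trans (cong p (sym (proj₂ (later t)))) (occ t))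
    (λ {t} {t′} t<t′ → ℕ.≤-pred (subst₂ _<ᶠ_ (proj₂ (later t)) (proj₂ (later t′)) (mono t<t′)))
    (λ u t e → ℕ.≤-pred (subst (_≤ᶠ suc u) (proj₂ (later t)) (least (suc u) t e)))
-- Parameter `zero` would have to occur before position `zero`.
wordOf {a} {suc k} {suc m} p first occ mono least | inj₂ (suc t) =
  contradiction (ℕ.≤-trans (mono {zero} {suc t} (s≤s z≤n)) (least zero (suc t) p₀)) λ ()
wordOf {a} {suc k} {suc m} p first occ mono least | inj₂ zero =
  new (proj₁ rest) , λ ρ σ → cong (letter (σ zero))
    (trans (proj₂ rest (σ zero ▸ ρ) (σ ∘ suc)) (tab-cong (shift-eval ρ σ ∘ p ∘ suc)))
  where
  later : ∀ t → ∃ λ v → first (suc t) ≡ suc v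
  later t = positive (first (suc t)) λ e →
    contradiction (subst (first zero <ᶠ_) e (mono {zero} {suc t} (s≤s z≤n))) λ ()
  rest = wordOf (shift ∘ p ∘ suc) (proj₁ ∘ later)
    (λ t → cong shift (trans (cong p (sym (proj₂ (later t)))) (occ (suc t))))
    (λ {t} {t′} t<t′ → ℕ.≤-pred (subst₂ _<ᶠ_ (proj₂ (later t)) (proj₂ (later t′)) (mono (s≤s t<t′))))
    (λ u t e → ℕ.≤-pred (subst (_≤ᶠ suc u) (proj₂ (later t)) (least (suc u) (suc t) (shift-inj₂ (p (suc u)) e))))

-- The structure on n copies of the power set of an N-element set

-- Lexicographic, but with `suc zero` ahead of `zero`: a set containing the first element of
-- difference comes first.
before : ∀ {N} → W 2 0 N → W 2 0 N → Bool
before []                    []                    = false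
before (letter zero u)       (letter zero v)       = before u v
before (letter zero u)       (letter (suc zero) v) = false
before (letter (suc zero) u) (letter zero v)       = true
before (letter (suc zero) u) (letter (suc zero) v) = before u v

meets : ∀ {N} → W 2 0 N → W 2 0 N → Bool
meets []                    []                    = false
meets (letter zero u)       (letter y v)          = meets u v
meets (letter (suc zero) u) (letter zero v)       = meets u v
meets (letter (suc zero) u) (letter (suc zero) v) = true

before-irrefl : ∀ {N} (u : W 2 0 N) → before u u ≡ false
before-irrefl []                    = refl
before-irrefl (letter zero u)       = before-irrefl u
before-irrefl (letter (suc zero) u) = before-irrefl u

before-trans : ∀ {N} (u v w : W 2 0 N) → before u v ≡ true → before v w ≡ true → before u w ≡ true
before-trans [] [] [] () _
before-trans (letter zero u) (letter zero v) (letter zero w) p q = before-trans u v w p q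
before-trans (letter zero u) (letter zero v) (letter (suc zero) w) p ()
before-trans (letter zero u) (letter (suc zero) v) w () q
before-trans (letter (suc zero) u) (letter y v) (letter zero w) p q = refl
before-trans (letter (suc zero) u) (letter zero v) (letter (suc zero) w) p ()
before-trans (letter (suc zero) u) (letter (suc zero) v) (letter (suc zero) w) p q = before-trans u v w p q

before-total : ∀ {N} (u v : W 2 0 N) → u ≢ v → before u v ≡ true ⊎ before v u ≡ true
before-total [] [] u≢v = contradiction refl u≢v
before-total (letter zero u) (letter zero v) u≢v = before-total u v (u≢v ∘ cong (letter zero))
before-total (letter zero u) (letter (suc zero) v) _ = inj₂ refl
before-total (letter (suc zero) u) (letter zero v) _ = inj₁ refl
before-total (letter (suc zero) u) (letter (suc zero) v) u≢v = before-total u v (u≢v ∘ cong (letter (suc zero)))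

before-letter : ∀ {N} x (u v : W 2 0 N) → before (letter x u) (letter x v) ≡ before u v
before-letter zero       u v = refl
before-letter (suc zero) u v = refl

-- Parameters first occur in index order, so the composites first differ where the first parameter
-- distinguishing `u` from `v` first occurs.
before-comp : ∀ {a m N} (ρ : Fin a → Fin 2) (F : W a m N) u v →
              before (comp ρ F u) (comp ρ F v) ≡ before u v
before-comp ρ []           u v = refl
before-comp ρ (letter x F) u v = trans (before-letter (ρ x) _ _) (before-comp ρ F u v)
before-comp ρ (new F) (letter zero u) (letter zero v) = before-comp _ F u v
before-comp ρ (new F) (letter zero u) (letter (suc zero) v) = refl
before-comp ρ (new F) (letter (suc zero) u) (letter zero v) = refl
before-comp ρ (new F) (letter (suc zero) u) (letter (suc zero) v) = before-comp _ F u v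

Disjoint : ∀ {a} → (Fin a → Fin 2) → (Fin a → Fin 2) → Set
Disjoint σ τ = ∀ x → σ x ≡ zero ⊎ τ x ≡ zero

▸-disjoint : ∀ {a y z} {σ τ : Fin a → Fin 2} → y ≡ zero ⊎ z ≡ zero →
             Disjoint σ τ → Disjoint (y ▸ σ) (z ▸ τ)
▸-disjoint h dis zero    = h
▸-disjoint h dis (suc x) = dis x

meets-letter : ∀ {N x y} (u v : W 2 0 N) → x ≡ zero ⊎ y ≡ zero →
               meets (letter x u) (letter y v) ≡ meets u v
meets-letter                u v (inj₁ refl) = refl
meets-letter {x = zero}     u v (inj₂ refl) = refl
meets-letter {x = suc zero} u v (inj₂ refl) = refl

-- Two maps are needed because they diverge at a parameter with different values on the two sides.
-- Disjointness persists until a parameter is 1 on both sides, and there both computations end with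
-- `true`.
meets-comp : ∀ {a m N} (σ τ : Fin a → Fin 2) → Disjoint σ τ → (F : W a m N) → ∀ u v →
             meets (comp σ F u) (comp τ F v) ≡ meets u v
meets-comp σ τ dis []           u v = refl
meets-comp σ τ dis (letter x F) u v = trans (meets-letter _ _ (dis x)) (meets-comp σ τ dis F u v)
meets-comp σ τ dis (new F) (letter zero u) (letter z v) =
  meets-comp _ _ (▸-disjoint (inj₁ refl) dis) F u v
meets-comp σ τ dis (new F) (letter (suc zero) u) (letter zero v) =
  meets-comp _ _ (▸-disjoint (inj₂ refl) dis) F u v
meets-comp σ τ dis (new F) (letter (suc zero) u) (letter (suc zero) v) = refl

Vertex : ℕ → ℕ → Set
Vertex n N = Fin n × W 2 0 N

edge : ∀ {n N} → Vertex n N → Vertex n N → Bool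
edge (i , u) (j , v) with <-cmp i j
... | tri< _ _ _ = meets u v
... | tri≈ _ _ _ = false
... | tri> _ _ _ = not (meets v u)

less : ∀ {n N} → Vertex n N → Vertex n N → Bool
less (i , u) (j , v) with <-cmp i j
... | tri< _ _ _ = true
... | tri≈ _ _ _ = before u v
... | tri> _ _ _ = false

inPart : ∀ {n N} → Fin n → Vertex n N → Bool
inPart i (j , _) = does (i ≟ j)

module _ {n N} (x y : Vertex n N) where
  private
    i = proj₁ x
    j = proj₁ y
    u = proj₂ x
    v = proj₂ y

  edge-< : i <ᶠ j → edge x y ≡ meets u v
  edge-< i<j with <-cmp i j
  ... | tri< _ _ _  = refl
  ... | tri≈ i≮j _ _ = contradiction i<j i≮j
  ... | tri> i≮j _ _ = contradiction i<j i≮j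

  edge-> : j <ᶠ i → edge x y ≡ not (meets v u)
  edge-> j<i with <-cmp i j
  ... | tri< _ _ j≮i = contradiction j<i j≮i
  ... | tri≈ _ _ j≮i = contradiction j<i j≮i
  ... | tri> _ _ _   = refl

  edge-≡ : i ≡ j → edge x y ≡ false
  edge-≡ i≡j with <-cmp i j
  ... | tri< _ i≢j _ = contradiction i≡j i≢j
  ... | tri≈ _ _ _   = refl
  ... | tri> _ i≢j _ = contradiction i≡j i≢j

  less-< : i <ᶠ j → less x y ≡ true
  less-< i<j with <-cmp i j
  ... | tri< _ _ _  = refl
  ... | tri≈ i≮j _ _ = contradiction i<j i≮j
  ... | tri> i≮j _ _ = contradiction i<j i≮j

  less-≡ : i ≡ j → less x y ≡ before u v
  less-≡ i≡j with <-cmp i j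
  ... | tri< _ i≢j _ = contradiction i≡j i≢j
  ... | tri≈ _ _ _   = refl
  ... | tri> _ i≢j _ = contradiction i≡j i≢j

  less⇒ : less x y ≡ true → i <ᶠ j ⊎ (i ≡ j × before u v ≡ true)
  less⇒ h with <-cmp i j
  ... | tri< i<j _ _ = inj₁ i<j
  ... | tri≈ _ i≡j _ = inj₂ (i≡j , h)

inPart⇒ : ∀ {n N} i (x : Vertex n N) → inPart i x ≡ true → i ≡ proj₁ x
inPart⇒ i (j , _) h with i ≟ j
... | yes i≡j = i≡j

less-irrefl : ∀ {n N} (x : Vertex n N) → less x x ≡ false
less-irrefl (i , u) = trans (less-≡ (i , u) (i , u) refl) (before-irrefl u)

less-trans : ∀ {n N} (x y z : Vertex n N) → less x y ≡ true → less y z ≡ true → less x z ≡ true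
less-trans x@(i , u) y@(j , v) z@(l , w) p q with less⇒ x y p | less⇒ y z q
... | inj₁ i<j        | inj₁ j<l        = less-< x z (ℕ.<-trans i<j j<l)
... | inj₁ i<j        | inj₂ (refl , _) = less-< x z i<j
... | inj₂ (refl , _) | inj₁ j<l        = less-< x z j<l
... | inj₂ (refl , a) | inj₂ (refl , b) = trans (less-≡ x z refl) (before-trans u v w a b)

less-total : ∀ {n N} (x y : Vertex n N) → x ≢ y → less x y ≡ true ⊎ less y x ≡ true
less-total x@(i , u) y@(j , v) x≢y with <-cmp i j
... | tri< i<j _ _  = inj₁ refl
... | tri> _ _ j<i  = inj₂ (less-< y x j<i)
... | tri≈ _ refl _ with before-total u v (x≢y ∘ cong (i ,_))
... | inj₁ h = inj₁ h
... | inj₂ h = inj₂ (trans (less-≡ y x refl) h)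

-- Numbering the vertices

encW : ∀ {N} → W 2 0 N → Fin (2 ^ N)
encW []           = zero
encW (letter x u) = combine x (encW u)

decW : ∀ N → Fin (2 ^ N) → W 2 0 N
decW zero    c = []
decW (suc N) c = letter (proj₁ (remQuot {2} (2 ^ N) c)) (decW N (proj₂ (remQuot {2} (2 ^ N) c)))

decW-encW : ∀ {N} (u : W 2 0 N) → decW N (encW u) ≡ u
decW-encW []                   = refl
decW-encW {suc N} (letter x u) = trans
  (cong (λ q → letter (proj₁ q) (decW N (proj₂ q))) (remQuot-combine x (encW u)))
  (cong (letter x) (decW-encW u))

encW-decW : ∀ N c → encW (decW N c) ≡ c
encW-decW zero    zero = refl
encW-decW (suc N) c    = trans
  (cong (combine (proj₁ (remQuot {2} (2 ^ N) c))) (encW-decW N _)) (combine-remQuot {2} (2 ^ N) c)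

enc : ∀ {n N} → Vertex n N → Fin (n * 2 ^ N)
enc (i , u) = combine i (encW u)

dec : ∀ n N → Fin (n * 2 ^ N) → Vertex n N
dec n N z = proj₁ (remQuot {n} (2 ^ N) z) , decW N (proj₂ (remQuot {n} (2 ^ N) z))

dec-enc : ∀ {n N} (x : Vertex n N) → dec n N (enc x) ≡ x
dec-enc {n} {N} (i , u) = trans
  (cong (λ q → proj₁ q , decW N (proj₂ q)) (remQuot-combine i (encW u)))
  (cong (i ,_) (decW-encW u))

enc-dec : ∀ n N z → enc (dec n N z) ≡ z
enc-dec n N z = trans
  (cong (combine (proj₁ (remQuot {n} (2 ^ N) z))) (encW-decW N _)) (combine-remQuot {n} (2 ^ N) z)

cube : ∀ n N → Str n
cube n N = record
  { size = n * 2 ^ N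
  ; E    = λ x y → edge (dec n N x) (dec n N y)
  ; P    = λ i x → inPart i (dec n N x)
  ; lt   = λ x y → less (dec n N x) (dec n N y)
  }

edge-asym : ∀ {n N} (x y : Vertex n N) → edge x y ≡ true → edge y x ≡ false
edge-asym x@(i , u) y@(j , v) h with <-cmp i j
... | tri< i<j _ _ = trans (edge-> y x i<j) (cong not h)
... | tri> _ _ j<i = trans (edge-< y x j<i) (trans (sym (not-involutive _)) (cong not h))

perp⇒samePart : ∀ {n N} (x y : Vertex n N) → edge x y ≡ false → edge y x ≡ false → proj₁ x ≡ proj₁ y
perp⇒samePart x@(i , u) y@(j , v) h h′ with <-cmp i j
... | tri≈ _ i≡j _ = i≡j
... | tri< i<j _ _ = contradiction (trans (sym h′) (trans (edge-> y x i<j) (cong not h))) λ ()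
... | tri> _ _ j<i = contradiction (trans (sym h) (cong not (trans (sym (edge-< y x j<i)) h′))) λ ()

cube-inAge : ∀ n N → InAge n (cube n N)
cube-inAge n N =
    ((λ x → edge-≡ (d x) (d x) refl) , (λ x y → edge-asym (d x) (d y)))
  , ((λ x → less-irrefl (d x)) , (λ x y z → less-trans (d x) (d y) (d z)) ,
     (λ x y x≢y → less-total (d x) (d y)
       (λ e → x≢y (trans (sym (enc-dec n N x)) (trans (cong enc e) (enc-dec n N y))))))
  , ((λ x → proj₁ (d x) , dec-true (proj₁ (d x) ≟ proj₁ (d x)) refl) ,
     (λ i j x p q → trans (inPart⇒ i (d x) p) (sym (inPart⇒ j (d x) q))))
  , (λ x y → (λ (h , h′) → proj₁ (d x) , dec-true (proj₁ (d x) ≟ proj₁ (d x)) refl ,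
                 dec-true (_ ≟ _) (perp⇒samePart (d x) (d y) h h′)) ,
             (λ i p q → let e = trans (sym (inPart⇒ i (d x) p)) (inPart⇒ i (d y) q) in
                 edge-≡ (d x) (d y) e , edge-≡ (d y) (d x) (sym e)))
  , (λ i j x y i<j p q → less-< (d x) (d y)
       (subst₂ _<ᶠ_ (inPart⇒ i (d x) p) (inPart⇒ j (d y) q) i<j))
  where d = dec n N

-- Action of parameter words on vertices

ρ₀ : Fin 1 → Fin 2
ρ₀ _ = zero

move : ∀ {n m N} → W 1 m N → Vertex n m → Vertex n N
move F (i , u) = i , comp ρ₀ F u

edge-move : ∀ {n m N} (F : W 1 m N) (x y : Vertex n m) → edge (move F x) (move F y) ≡ edge x y
edge-move F (i , u) (j , v) with <-cmp i j
... | tri< _ _ _ = meets-comp ρ₀ ρ₀ (λ _ → inj₁ refl) F u v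
... | tri≈ _ _ _ = refl
... | tri> _ _ _ = cong not (meets-comp ρ₀ ρ₀ (λ _ → inj₁ refl) F v u)

less-move : ∀ {n m N} (F : W 1 m N) (x y : Vertex n m) → less (move F x) (move F y) ≡ less x y
less-move F (i , u) (j , v) with <-cmp i j
... | tri< _ _ _ = refl
... | tri≈ _ _ _ = before-comp ρ₀ F u v
... | tri> _ _ _ = refl

-- Sorting a structure

relabel : ∀ {n} (A : Str n) → (Fin (size A) → Fin (size A)) → Str n
relabel A o = record
  { size = size A
  ; E    = λ x y → E A (o x) (o y)
  ; P    = λ i x → P A i (o x)
  ; lt   = λ x y → lt A (o x) (o y)
  }

-- Columns are numbered through the universe `Fin (size A)`, so its order has to agree with `lt` for
-- codes to respect `lt`.
Sorted : ∀ {n} → Str n → Set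
Sorted A = ∀ {x y} → x <ᶠ y → lt A x y ≡ true

relabel-inAge : ∀ {n} (A : Str n) o → Injective _≡_ _≡_ o → InAge n A → InAge n (relabel A o)
relabel-inAge A o inj ((irr , asym) , (ltirr , lttrans , lttotal) , (ex , uniq) , perp , ord) =
    ((λ x → irr (o x)) , (λ x y → asym (o x) (o y)))
  , ((λ x → ltirr (o x)) , (λ x y z → lttrans (o x) (o y) (o z)) , (λ x y x≢y → lttotal (o x) (o y) (x≢y ∘ inj)))
  , ((λ x → ex (o x)) , (λ i j x → uniq i j (o x)))
  , (λ x y → perp (o x) (o y))
  , (λ i j x y → ord i j (o x) (o y))

IsCopy-iso : ∀ {n} {A A′ C : Str n} (h : Fin (size A′) → Fin (size A)) (h⁻¹ : Fin (size A) → Fin (size A′)) →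
             (∀ x → h (h⁻¹ x) ≡ x) → IsEmbedding A′ A h → ∀ {S} → IsCopy A C S → IsCopy A′ C S
IsCopy-iso h h⁻¹ right (hinj , hE , hlt , hP) (f , (finj , fE , flt , fP) , img) =
  f ∘ h , (hinj ∘ finj , (λ x y → trans (fE _ _) (hE x y)) , (λ x y → trans (flt _ _) (hlt x y)) ,
           (λ i x → trans (fP i _) (hP i x))) ,
  λ z → (λ z∈S → let x , e = proj₁ (img z) z∈S in h⁻¹ x , trans (cong f (right x)) e) ,
        (λ x → proj₂ (img z) (h x))

∈-tabulate⁺ : ∀ {m} {f : Fin m → Bool} {x} → f x ≡ true → x ∈ tabulate f
∈-tabulate⁺ {f = f} {x} e = lookup⇒[]= x _ (trans (lookup∘tabulate f x) e)

∈-tabulate⁻ : ∀ {m} {f : Fin m → Bool} {x} → x ∈ tabulate f → f x ≡ true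
∈-tabulate⁻ {f = f} {x} h = trans (sym (lookup∘tabulate f x)) ([]=⇒lookup h)

true≢false : true ≢ false
true≢false ()

-- Punching out a missed value would inject `Fin (suc m)` into `Fin m`.
injective⇒surjective : ∀ {m} (f : Fin m → Fin m) → Injective _≡_ _≡_ f → ∀ y → ∃ λ x → f x ≡ y
injective⇒surjective {suc m} f inj y with any? (λ x → f x ≟ y)
... | yes h = h
... | no ¬h = contradiction
  (injective⇒≤ {f = λ x → punchOut {i = y} {j = f x} (λ e → ¬h (x , sym e))}
    (λ e → inj (punchOut-injective (λ e → ¬h (_ , sym e)) (λ e → ¬h (_ , sym e)) e)))
  ℕ.1+n≰n

module _ {n} (A : Str n) (linear : IsLinearOrder A) where
  private
    ltirr = proj₁ linear
    lttrans = proj₁ (proj₂ linear)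
    lttotal = proj₂ (proj₂ linear)

    down-set : Fin (size A) → Subset (size A)
    down-set x = tabulate (λ y → lt A y x)

    rank<size : ∀ x → ∣ down-set x ∣ < size A
    rank<size x = subst (∣ down-set x ∣ <_) (∣⊤∣≡n (size A))
      (p⊂q⇒∣p∣<∣q∣ ((λ _ → ∈⊤) , x , ∈⊤ , λ h → true≢false (trans (sym (∈-tabulate⁻ h)) (ltirr x))))

  rank : Fin (size A) → Fin (size A)
  rank x = fromℕ< (rank<size x)

  rank-mono : ∀ x y → lt A x y ≡ true → rank x <ᶠ rank y
  rank-mono x y x<y = subst₂ _<_ (sym (toℕ-fromℕ< _)) (sym (toℕ-fromℕ< _))
    (p⊂q⇒∣p∣<∣q∣ ((λ h → ∈-tabulate⁺ (lttrans _ x y (∈-tabulate⁻ h) x<y)) ,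
                   x , ∈-tabulate⁺ x<y , λ h → true≢false (trans (sym (∈-tabulate⁻ h)) (ltirr x))))

  rank-injective : Injective _≡_ _≡_ rank
  rank-injective {x} {y} e with x ≟ y
  ... | yes x≡y = x≡y
  ... | no x≢y with lttotal x y x≢y
  ... | inj₁ x<y = contradiction (rank-mono x y x<y) (<-irrefl e)
  ... | inj₂ y<x = contradiction (rank-mono y x y<x) (<-irrefl (sym e))

  unrank : Fin (size A) → Fin (size A)
  unrank t = proj₁ (injective⇒surjective rank rank-injective t)

  rank-unrank : ∀ t → rank (unrank t) ≡ t
  rank-unrank t = proj₂ (injective⇒surjective rank rank-injective t)

  unrank-rank : ∀ x → unrank (rank x) ≡ x
  unrank-rank x = rank-injective (rank-unrank (rank x))

  unrank-injective : Injective _≡_ _≡_ unrank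
  unrank-injective {s} {t} e = trans (sym (rank-unrank s)) (trans (cong rank e) (rank-unrank t))

  sort : Str n
  sort = relabel A unrank

  sort-sorted : Sorted sort
  sort-sorted {s} {t} s<t with lttotal (unrank s) (unrank t) (λ e → <-irrefl (unrank-injective e) s<t)
  ... | inj₁ h = h
  ... | inj₂ h = contradiction
    (subst₂ _<ᶠ_ (rank-unrank t) (rank-unrank s) (rank-mono _ _ h)) (<-asym s<t)

  copy-sort : ∀ {C S} → IsCopy A C S → IsCopy sort C S
  copy-sort {C} = IsCopy-iso {A = A} {A′ = sort} {C} unrank rank unrank-rank
    (unrank-injective , (λ _ _ → refl) , (λ _ _ → refl) , (λ _ _ → refl))

  copy-unsort : ∀ {C S} → IsCopy sort C S → IsCopy A C S
  copy-unsort {C} = IsCopy-iso {A = sort} {A′ = A} {C} rank unrank rank-unrank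
    (rank-injective , (λ x y → cong₂ (E A) (unrank-rank x) (unrank-rank y)) ,
     (λ x y → cong₂ (lt A) (unrank-rank x) (unrank-rank y)) ,
     (λ i x → cong (P A i) (unrank-rank x)))

-- Coding a sorted structure

before-tab : ∀ {N} (σ τ : Fin N → Fin 2) q → σ q ≡ suc zero → τ q ≡ zero →
             (∀ u → u <ᶠ q → σ u ≡ τ u) → before (tab σ) (tab τ) ≡ true
before-tab σ τ zero    σq τq agree rewrite σq | τq = refl
before-tab σ τ (suc q) σq τq agree rewrite agree zero (s≤s z≤n) =
  trans (before-letter (τ zero) _ _)
    (before-tab (σ ∘ suc) (τ ∘ suc) q σq τq (λ u u<q → agree (suc u) (s≤s u<q)))

meets-tab⁺ : ∀ {N} (σ τ : Fin N → Fin 2) q → σ q ≡ suc zero → τ q ≡ suc zero →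
             meets (tab σ) (tab τ) ≡ true
meets-tab⁺ σ τ zero    σq τq rewrite σq | τq = refl
meets-tab⁺ σ τ (suc q) σq τq with σ zero | τ zero
... | zero     | _        = meets-tab⁺ (σ ∘ suc) (τ ∘ suc) q σq τq
... | suc zero | zero     = meets-tab⁺ (σ ∘ suc) (τ ∘ suc) q σq τq
... | suc zero | suc zero = refl

meets-tab⁻ : ∀ {N} (σ τ : Fin N → Fin 2) → meets (tab σ) (tab τ) ≡ true →
             ∃ λ q → σ q ≡ suc zero × τ q ≡ suc zero
meets-tab⁻ {suc N} σ τ h with σ zero in σ₀ | τ zero in τ₀
... | zero     | _        = let q , e = meets-tab⁻ (σ ∘ suc) (τ ∘ suc) h in suc q , e
... | suc zero | zero     = let q , e = meets-tab⁻ (σ ∘ suc) (τ ∘ suc) h in suc q , e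
... | suc zero | suc zero = zero , σ₀ , τ₀

toBit : Bool → Fin 2
toBit false = zero
toBit true  = suc zero

toBit-true : ∀ {b} → toBit b ≡ suc zero → b ≡ true
toBit-true {true} _ = refl

combine-monoʳ-≤ : ∀ {m k} (i : Fin m) {j l : Fin k} → j ≤ᶠ l → combine i j ≤ᶠ combine i l
combine-monoʳ-≤ {m} {k} i {j} {l} j≤l = subst₂ _≤_ (sym (toℕ-combine i j)) (sym (toℕ-combine i l))
  (ℕ.+-monoʳ-≤ (k * toℕ i) j≤l)

combine-monoʳ-< : ∀ {m k} (i : Fin m) {j l : Fin k} → j <ᶠ l → combine i j <ᶠ combine i l
combine-monoʳ-< {m} {k} i {j} {l} j<l = subst₂ _<_ (sym (toℕ-combine i j)) (sym (toℕ-combine i l))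
  (ℕ.+-monoʳ-< (k * toℕ i) j<l)

combine-lex : ∀ {m k} (i i′ : Fin m) (j j′ : Fin k) → combine i j <ᶠ combine i′ j′ →
              i <ᶠ i′ ⊎ (i ≡ i′ × j <ᶠ j′)
combine-lex i i′ j j′ h with <-cmp i i′
... | tri< i<i′ _ _ = inj₁ i<i′
... | tri> _ _ i′<i = contradiction (combine-monoˡ-< j′ j i′<i) (<-asym h)
... | tri≈ _ refl _ with ℕ.<-≤-connex (toℕ j) (toℕ j′)
... | inj₁ j<j′ = inj₂ (refl , j<j′)
... | inj₂ j′≤j = contradiction (ℕ.<-≤-trans h (combine-monoʳ-≤ i j′≤j)) (ℕ.<-irrefl refl)

eq : ∀ {m} → Fin m → Fin m → Bool
eq x y = does (x ≟ y)

eq⇒≡ : ∀ {m} (x y : Fin m) → eq x y ≡ true → x ≡ y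
eq⇒≡ x y h with x ≟ y
... | yes x≡y = x≡y

-- Block `t` opens with the private column `(t , zero)`; `(t , suc u)` serves an edge from `u` to a
-- larger `t`. Keeping edges in the block of the larger end leaves all blocks before `z` empty in
-- the code of `z`.
Column : ∀ {n} → Str n → Set
Column A = Fin (size A) × Fin (suc (size A))

columns : ∀ {n} → Str n → ℕ
columns A = size A * suc (size A)

column : ∀ {n} (A : Str n) → Fin (columns A) → Column A
column A = remQuot (suc (size A))

index : ∀ {n} (A : Str n) → Column A → Fin (columns A)
index A (t , c) = combine t c

-- A reversed edge, or no edge within a part, shows as disjointness of the codes, so only edges
-- agreeing with the order are marked.
link : ∀ {n} (A : Str n) → Fin (size A) → Fin (size A) → Bool
link A t u = lt A u t ∧ E A u t

-- A column belongs to the codes of at most two vertices, so its trace on a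
-- substructure is empty, or that of a column (x , 0), or that of a column
-- given by two vertices of the substructure.
bit : ∀ {n} (A : Str n) → Fin (size A) → Column A → Bool
bit A z (t , zero)  = eq t z
bit A z (t , suc u) = link A t u ∧ (eq t z ∨ eq u z)

codeword : ∀ {n} (A : Str n) → Fin (size A) → W 2 0 (columns A)
codeword A z = tab (toBit ∘ bit A z ∘ column A)

vertex : ∀ {n} (A : Str n) → PartsPartition A → Fin (size A) → Vertex n (columns A)
vertex A (ex , _) z = proj₁ (ex z) , codeword A z

index-column : ∀ {n} (A : Str n) u → index A (column A u) ≡ u
index-column A u = combine-remQuot {size A} (suc (size A)) u

bit-index : ∀ {n} (A : Str n) z (q : Column A) → bit A z (column A (index A q)) ≡ bit A z q
bit-index A z (t , c) = cong (bit A z) (remQuot-combine t c)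

∨-true : ∀ {a b} → a ∨ b ≡ true → a ≡ true ⊎ b ≡ true
∨-true {true}  h = inj₁ refl
∨-true {false} h = inj₂ h

bool-ext : ∀ {a b : Bool} → (a ≡ true → b ≡ true) → (b ≡ true → a ≡ true) → a ≡ b
bool-ext {true}          f g = sym (f refl)
bool-ext {false} {true}  f g = g refl
bool-ext {false} {false} f g = refl

module _ {n} (B : Str n) (KB : InAge n B) (sorted : Sorted B) where
  private
    asym    = proj₂ (proj₁ KB)
    ltirr   = proj₁ (proj₁ (proj₂ KB))
    lttrans = proj₁ (proj₂ (proj₁ (proj₂ KB)))
    lttotal = proj₂ (proj₂ (proj₁ (proj₂ KB)))
    pp      = proj₁ (proj₂ (proj₂ KB))
    perp    = proj₁ (proj₂ (proj₂ (proj₂ KB)))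
    ord     = proj₂ (proj₂ (proj₂ (proj₂ KB)))
    part    = λ x → proj₁ (proj₁ pp x)
    inpart  = λ x → proj₂ (proj₁ pp x)

  lt⇒< : ∀ {x y} → lt B x y ≡ true → x <ᶠ y
  lt⇒< {x} {y} h with <-cmp x y
  ... | tri< x<y _ _  = x<y
  ... | tri≈ _ refl _ = contradiction (trans (sym h) (ltirr x)) true≢false
  ... | tri> _ _ y<x  = contradiction (trans (sym (lttrans x y x h (sorted y<x))) (ltirr x)) true≢false

  link⇒< : ∀ {t u} → link B t u ≡ true → u <ᶠ t
  link⇒< {t} {u} h = lt⇒< (∧-conicalˡ (lt B u t) (E B u t) h)

  bit-early : ∀ {z t} c → t <ᶠ z → bit B z (t , c) ≡ false
  bit-early {z} {t} zero    t<z = dec-false (t ≟ z) (λ e → <-irrefl e t<z)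
  bit-early {z} {t} (suc u) t<z with link B t u in l
  ... | false = refl
  ... | true  = cong₂ _∨_ (dec-false (t ≟ z) (λ e → <-irrefl e t<z))
                          (dec-false (u ≟ z) (λ e → <-irrefl e (ℕ.<-trans (link⇒< l) t<z)))

  -- The codes first differ at the private column of `x`: all earlier columns are empty for both
  -- vertices.
  codeword-mono : ∀ {x y} → x <ᶠ y → before (codeword B x) (codeword B y) ≡ true
  codeword-mono {x} {y} x<y = before-tab _ _ (index B (x , zero))
    (cong toBit (trans (bit-index B x (x , zero)) (dec-true (x ≟ x) refl)))
    (cong toBit (trans (bit-index B y (x , zero)) (dec-false (x ≟ y) (λ e → <-irrefl e x<y))))
    agree
    where
    agree : ∀ u → u <ᶠ index B (x , zero) →
            toBit (bit B x (column B u)) ≡ toBit (bit B y (column B u))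
    agree u u<x
      with combine-lex _ x _ zero (subst (_<ᶠ index B (x , zero)) (sym (index-column B u)) u<x)
    -- Nothing in block `x` precedes `(x , zero)`, so only earlier blocks arise.
    ... | inj₁ t<x = cong toBit (trans (bit-early (proj₂ (column B u)) t<x)
                                            (sym (bit-early (proj₂ (column B u)) (ℕ.<-trans t<x x<y))))

  -- A column common to two vertices is not private, so its two ends are `x` and `y`, and being
  -- linked makes it the edge from `x` to `y`. Conversely that edge fills column `(y , suc x)`.
  meets-codeword : ∀ {x y} → x <ᶠ y → meets (codeword B x) (codeword B y) ≡ E B x y
  meets-codeword {x} {y} x<y = bool-ext to from
    where
    common : ∀ q → bit B x q ≡ true → bit B y q ≡ true → E B x y ≡ true
    common (t , zero)  p q = contradiction x<y (<-irrefl (trans (sym (eq⇒≡ t x p)) (eq⇒≡ t y q)))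
    common (t , suc u) p q
      with ∨-true (∧-conicalʳ (link B t u) _ p) | ∨-true (∧-conicalʳ (link B t u) _ q)
    ... | inj₁ a | inj₁ b = contradiction x<y (<-irrefl (trans (sym (eq⇒≡ t x a)) (eq⇒≡ t y b)))
    ... | inj₂ a | inj₂ b = contradiction x<y (<-irrefl (trans (sym (eq⇒≡ u x a)) (eq⇒≡ u y b)))
    ... | inj₁ a | inj₂ b = contradiction
      (subst₂ _<ᶠ_ (eq⇒≡ u y b) (eq⇒≡ t x a) (link⇒< (∧-conicalˡ (link B t u) _ p))) (<-asym x<y)
    ... | inj₂ a | inj₁ b = subst₂ (λ v w → E B v w ≡ true) (eq⇒≡ u x a) (eq⇒≡ t y b)
      (∧-conicalʳ (lt B u t) (E B u t) (∧-conicalˡ (link B t u) _ p))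
    to : meets (codeword B x) (codeword B y) ≡ true → E B x y ≡ true
    to h = let q , p , p′ = meets-tab⁻ _ _ h in
      common (column B q) (toBit-true p) (toBit-true p′)
    from : E B x y ≡ true → meets (codeword B x) (codeword B y) ≡ true
    from h = meets-tab⁺ _ _ (index B (y , suc x))
      (cong toBit (trans (bit-index B x (y , suc x))
        (cong₂ _∧_ linked (trans (cong (eq y x ∨_) (dec-true (x ≟ x) refl)) (∨-zeroʳ _)))))
      (cong toBit (trans (bit-index B y (y , suc x))
        (cong₂ (λ l e → l ∧ (e ∨ eq x y)) linked (dec-true (y ≟ y) refl))))
      where
      linked : link B y x ≡ true
      linked = cong₂ _∧_ (sorted x<y) h

  part<⇒< : ∀ {x y} → part x <ᶠ part y → x <ᶠ y
  part<⇒< {x} {y} h = lt⇒< (ord _ _ x y h (inpart x) (inpart y))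

  E-flip : ∀ {x y} → part x ≢ part y → not (E B y x) ≡ E B x y
  E-flip {x} {y} px≢py with E B x y in exy | E B y x in eyx
  ... | true  | true  = contradiction (trans (sym eyx) (asym x y exy)) true≢false
  ... | true  | false = refl
  ... | false | true  = refl
  ... | false | false = let i , px , py = proj₁ (perp x y) (exy , eyx) in
    contradiction (trans (proj₂ pp _ i x (inpart x) px) (proj₂ pp i _ y py (inpart y))) px≢py

  vertex-edge : ∀ x y → edge (vertex B pp x) (vertex B pp y) ≡ E B x y
  vertex-edge x y = by-cases (<-cmp (part x) (part y))
    where
    by-cases : Tri _ _ _ → _
    by-cases (tri< p<q _ _) = trans (edge-< (vertex B pp x) (vertex B pp y) p<q) (meets-codeword (part<⇒< p<q))
    by-cases (tri≈ _ p≡q _) = trans (edge-≡ (vertex B pp x) (vertex B pp y) p≡q)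
      (sym (proj₁ (proj₂ (perp x y) (part x) (inpart x)
        (subst (λ i → P B i y ≡ true) (sym p≡q) (inpart y)))))
    by-cases (tri> _ p≢q q<p) = trans (edge-> (vertex B pp x) (vertex B pp y) q<p)
      (trans (cong not (meets-codeword (part<⇒< q<p))) (E-flip p≢q))

  vertex-mono : ∀ x y → lt B x y ≡ true → less (vertex B pp x) (vertex B pp y) ≡ true
  vertex-mono x y h = by-cases (<-cmp (part x) (part y))
    where
    by-cases : Tri _ _ _ → _
    by-cases (tri< p<q _ _) = less-< (vertex B pp x) (vertex B pp y) p<q
    by-cases (tri≈ _ p≡q _) = trans (less-≡ (vertex B pp x) (vertex B pp y) p≡q) (codeword-mono (lt⇒< h))
    by-cases (tri> _ _ q<p) = contradiction (part<⇒< q<p) (<-asym (lt⇒< h))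

  vertex-less : ∀ x y → less (vertex B pp x) (vertex B pp y) ≡ lt B x y
  vertex-less x y = bool-ext reflects (vertex-mono x y)
    where
    v = vertex B pp
    reflects : less (v x) (v y) ≡ true → lt B x y ≡ true
    reflects h with x ≟ y
    ... | yes refl = contradiction (trans (sym h) (less-irrefl (v x))) true≢false
    ... | no x≢y with lttotal x y x≢y
    ... | inj₁ x<y = x<y
    ... | inj₂ y<x = contradiction
      (trans (sym (less-trans (v x) (v y) (v x) h (vertex-mono y x y<x))) (less-irrefl (v x))) true≢false

  vertex-part : ∀ i x → inPart i (vertex B pp x) ≡ P B i x
  vertex-part i x = bool-ext
    (λ h → subst (λ j → P B j x ≡ true) (sym (inPart⇒ i (vertex B pp x) h)) (inpart x))
    (λ h → dec-true (i ≟ part x) (proj₂ pp i (part x) x h (inpart x)))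

  embed : ∀ {N} → W 1 (columns B) N → Fin (size B) → Fin (size (cube n N))
  embed F x = enc (move F (vertex B pp x))

  embed-isEmbedding : ∀ {N} (F : W 1 (columns B) N) → IsEmbedding B (cube n N) (embed F)
  embed-isEmbedding {N} F = inj , E-pres , lt-pres ,
    λ i x → trans (cong (inPart i) (dec-enc (v x))) (vertex-part i x)
    where
    v : Fin (size B) → Vertex n N
    v x = move F (vertex B pp x)
    E-pres : ∀ x y → E (cube n N) (embed F x) (embed F y) ≡ E B x y
    E-pres x y = trans (cong₂ edge (dec-enc (v x)) (dec-enc (v y)))
      (trans (edge-move F (vertex B pp x) (vertex B pp y)) (vertex-edge x y))
    lt-pres : ∀ x y → lt (cube n N) (embed F x) (embed F y) ≡ lt B x y
    lt-pres x y = trans (cong₂ less (dec-enc (v x)) (dec-enc (v y)))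
      (trans (less-move F (vertex B pp x) (vertex B pp y)) (vertex-less x y))
    inj : Injective _≡_ _≡_ (embed F)
    inj {x} {y} e with x ≟ y
    ... | yes x≡y = x≡y
    ... | no x≢y with lttotal x y x≢y
    ... | inj₁ x<y = contradiction (trans (sym x<y) (trans (sym (lt-pres x y))
      (trans (cong (λ z → lt (cube n N) z (embed F y)) e) (trans (lt-pres y y) (ltirr y))))) true≢false
    ... | inj₂ y<x = contradiction (trans (sym y<x) (trans (sym (lt-pres y x))
      (trans (cong (lt (cube n N) (embed F y)) e) (trans (lt-pres y y) (ltirr y))))) true≢false

-- The word of an embedding

module _ {n} (A B : Str n) (KA : InAge n A) (KB : InAge n B) (sA : Sorted A) (sB : Sorted B)
         (f : Fin (size A) → Fin (size B)) (emb : IsEmbedding A B f) where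
  private
    finj = proj₁ emb
    fE   = proj₁ (proj₂ emb)
    flt  = proj₁ (proj₂ (proj₂ emb))
    fP   = proj₂ (proj₂ (proj₂ emb))

    Preimage : Fin (size B) → Set
    Preimage t = Dec (∃ λ x → f x ≡ t)

    preimage : ∀ t → Preimage t
    preimage t = any? (λ x → f x ≟ t)

  f-mono : ∀ {x y} → x <ᶠ y → f x <ᶠ f y
  f-mono {x} {y} x<y = lt⇒< B KB sB (trans (flt x y) (sA x<y))

  link-f : ∀ x y → link B (f x) (f y) ≡ link A x y
  link-f x y = cong₂ _∧_ (flt y x) (fE y x)

  eq-f : ∀ x y → eq (f x) (f y) ≡ eq x y
  eq-f x y = bool-ext (λ h → dec-true (x ≟ y) (finj (eq⇒≡ (f x) (f y) h)))
                      (λ h → dec-true (f x ≟ f y) (cong f (eq⇒≡ x y h)))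

  -- A column of A with the same trace on A as the given column of B; nothing
  -- stands for the empty trace.
  trace₁ : ∀ {t u} → Preimage t → Preimage u → Bool → Maybe (Column A)
  trace₁ (yes (x , _)) (yes (y , _)) _     = just (x , suc y)
  trace₁ (yes (x , _)) (no _)        true  = just (x , zero)
  trace₁ (no _)        (yes (y , _)) true  = just (y , zero)
  trace₁ _             _             _     = nothing

  trace₀ : ∀ {t} → Preimage t → Maybe (Column A)
  trace₀ (yes (x , _)) = just (x , zero)
  trace₀ (no _)        = nothing

  trace : Column B → Maybe (Column A)
  trace (t , zero)  = trace₀ (preimage t)
  trace (t , suc u) = trace₁ (preimage t) (preimage u) (link B t u)


  -- `f` preserves `link` and equality, and an end of `q` outside the image of `f` never equals
  -- `f z`.
  bit-trace : ∀ z q → bit B (f z) q ≡ maybe (bit A z) false (trace q)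
  bit-trace z (t , zero) with preimage t
  ... | yes (x , refl) = eq-f x z
  ... | no ¬x          = dec-false (t ≟ f z) (λ e → ¬x (z , sym e))
  bit-trace z (t , suc u) with preimage t | preimage u
  ... | yes (x , refl) | yes (y , refl) = cong₂ _∧_ (link-f x y) (cong₂ _∨_ (eq-f x z) (eq-f y z))
  ... | yes (x , refl) | no ¬y with link B (f x) u
  ...   | true  = trans (cong₂ _∨_ (eq-f x z) (dec-false (u ≟ f z) (λ e → ¬y (z , sym e)))) (∨-identityʳ _)
  ...   | false = refl
  bit-trace z (t , suc u) | no ¬x | yes (y , refl) with link B t (f y)
  ...   | true  = cong₂ _∨_ (dec-false (t ≟ f z) (λ e → ¬x (z , sym e))) (eq-f y z)
  ...   | false = refl
  bit-trace z (t , suc u) | no ¬x | no ¬y = trans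
    (cong (link B t u ∧_) (cong₂ _∨_ (dec-false (t ≟ f z) (λ e → ¬x (z , sym e)))
                                     (dec-false (u ≟ f z) (λ e → ¬y (z , sym e)))))
    (∧-zeroʳ (link B t u))

  image-column : Column A → Column B
  image-column (x , c) = f x , lift f c

  -- Each column of `A` must occur as a parameter, even an unlinked and hence empty one; this is why
  -- `trace₁` ignores the link when both ends lie in the image.
  trace-image : ∀ q → trace (image-column q) ≡ just q
  trace-image (x , zero) with preimage (f x)
  ... | yes (x′ , e) = cong (λ v → just (v , zero)) (finj e)
  ... | no ¬x        = contradiction (x , refl) ¬x
  trace-image (x , suc y) with preimage (f x) | preimage (f y)
  ... | yes (x′ , e) | yes (y′ , e′) = cong₂ (λ v w → just (v , suc w)) (finj e) (finj e′)
  ... | no ¬x        | _             = contradiction (x , refl) ¬x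
  ... | yes _        | no ¬y         = contradiction (y , refl) ¬y

  -- The trace `(x , zero)` also comes from linked columns with one end outside the image. These lie
  -- later in block `f x`, or in the block of a larger outside vertex.
  trace-least : ∀ q q′ → trace q ≡ just q′ → index B (image-column q′) ≤ᶠ index B q
  trace-least (t , zero) q′ h with preimage t
  trace-least (t , zero) q′ refl | yes (x , refl) = ℕ.≤-refl
  trace-least (t , suc u) q′ h with preimage t | preimage u | link B t u in l
  trace-least (t , suc u) q′ refl | yes (x , refl) | yes (y , refl) | _    = ℕ.≤-refl
  trace-least (t , suc u) q′ refl | yes (x , refl) | no _           | true = combine-monoʳ-≤ (f x) z≤n
  trace-least (t , suc u) q′ refl | no _           | yes (y , refl) | true =
    ℕ.<⇒≤ (combine-monoˡ-< zero (suc u) (link⇒< B KB sB l))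

  lift-mono : ∀ {c c′} → c <ᶠ c′ → lift f c <ᶠ lift f c′
  lift-mono {zero}  {suc c′} _         = s≤s z≤n
  lift-mono {suc c} {suc c′} (s≤s c<c′) = s≤s (f-mono c<c′)

  image-mono : ∀ q q′ → index A q <ᶠ index A q′ → index B (image-column q) <ᶠ index B (image-column q′)
  image-mono (x , c) (x′ , c′) h with combine-lex x x′ c c′ h
  ... | inj₁ x<x′          = combine-monoˡ-< (lift f c) (lift f c′) (f-mono x<x′)
  ... | inj₂ (refl , c<c′) = combine-monoʳ-< (f x) (lift-mono c<c′)

  private
    symbol : Maybe (Column A) → Fin 1 ⊎ Fin (columns A)
    symbol (just q) = inj₂ (index A q)
    symbol nothing  = inj₁ zero

    symbol-inj₂ : ∀ q {t} → symbol q ≡ inj₂ t → q ≡ just (column A t)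
    symbol-inj₂ (just (x , c)) refl = cong just (sym (remQuot-combine x c))

    eval-symbol : ∀ z q → [ ρ₀ , toBit ∘ bit A z ∘ column A ]′ (symbol q) ≡ toBit (maybe (bit A z) false q)
    eval-symbol z (just q) = cong toBit (bit-index A z q)
    eval-symbol z nothing  = refl

    word : ∃ λ (g : W 1 (columns A) (columns B)) → ∀ {b} (ρ : Fin 1 → Fin b) σ →
           comp ρ g (tab σ) ≡ tab ([ ρ , σ ]′ ∘ symbol ∘ trace ∘ column B)
    word = wordOf (symbol ∘ trace ∘ column B) (index B ∘ image-column ∘ column A)
      (λ t → trans (cong (symbol ∘ trace) (remQuot-combine _ _))
               (trans (cong symbol (trace-image (column A t))) (cong inj₂ (index-column A t))))
      (λ {t} {t′} t<t′ → image-mono (column A t) (column A t′)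
        (subst₂ _<ᶠ_ (sym (index-column A t)) (sym (index-column A t′)) t<t′))
      (λ u t e → subst (index B (image-column (column A t)) ≤ᶠ_) (index-column B u)
        (trace-least (column B u) (column A t) (symbol-inj₂ (trace (column B u)) e)))

  embeddingWord : W 1 (columns A) (columns B)
  embeddingWord = proj₁ word

  -- The symbols of the word are the traces of the columns of `B`, so by `bit-trace` substituting
  -- the code of `z` gives that of `f z`.
  move-embeddingWord : ∀ z → move embeddingWord (vertex A (proj₁ (proj₂ (proj₂ KA))) z)
                             ≡ vertex B (proj₁ (proj₂ (proj₂ KB))) (f z)
  move-embeddingWord z = cong₂ _,_
    (proj₂ ppB _ _ (f z) (trans (fP _ z) (proj₂ (proj₁ ppA z))) (proj₂ (proj₁ ppB (f z))))
    (trans (proj₂ word ρ₀ (toBit ∘ bit A z ∘ column A))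
      (tab-cong (λ u → trans (eval-symbol z (trace (column B u)))
                             (cong toBit (sym (bit-trace z (column B u)))))))
    where
    ppA = proj₁ (proj₂ (proj₂ KA))
    ppB = proj₁ (proj₂ (proj₂ KB))

-- The Ramsey property

image : ∀ {m N} → (Fin m → Fin N) → Subset N
image f = tabulate (λ z → does (any? (λ x → f x ≟ z)))

∈-image⁺ : ∀ {m N} (f : Fin m → Fin N) {z} x → f x ≡ z → z ∈ image f
∈-image⁺ f x e = ∈-tabulate⁺ (dec-true (any? _) (x , e))

∈-image⁻ : ∀ {m N} (f : Fin m → Fin N) {z} → z ∈ image f → ∃ λ x → f x ≡ z
∈-image⁻ f {z} h with any? (λ x → f x ≟ z) | ∈-tabulate⁻ h
... | yes p | _ = p

embedding-cancel : ∀ {n} (A B C : Str n) {φ h f} → IsEmbedding B C φ → IsEmbedding A C h →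
                   (∀ x → φ (f x) ≡ h x) → IsEmbedding A B f
embedding-cancel A B C {φ} {h} {f} (_ , φE , φlt , φP) (hinj , hE , hlt , hP) e =
    (λ {x} {y} fx≡fy → hinj (trans (sym (e x)) (trans (cong φ fx≡fy) (e y))))
  , (λ x y → trans (sym (φE _ _)) (trans (cong₂ (E C) (e x) (e y)) (hE x y)))
  , (λ x y → trans (sym (φlt _ _)) (trans (cong₂ (lt C) (e x) (e y)) (hlt x y)))
  , (λ i x → trans (sym (φP i _)) (trans (cong (P C i) (e x)) (hP i x)))

-- A word is coloured by the copy of `A` it yields. A copy inside the copy of `B` given by `F`
-- factors through an embedding `f` of `A` in `B`; if `g` is the word of `f`, it is the copy given
-- by `comp id F g`.
ramsey-sorted : ∀ {n} k (A B : Str n) → InAge n A → InAge n B → Sorted A → Sorted B →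
  ∃ λ (C : Str n) → InAge n C ×
    (∀ (χ : Subset (size C) → Fin k) →
      ∃ λ (T : Subset (size C)) → IsCopy B C T ×
        ∃ λ (c : Fin k) → ∀ (S : Subset (size C)) → S ⊆ T → IsCopy A C S → χ S ≡ c)
ramsey-sorted {n} k A B KA KB sA sB with grahamRothschild (columns A) 0 (columns B) k
... | N , gr = cube n N , cube-inAge n N , partition
  where
  partition : ∀ (χ : Subset (size (cube n N)) → Fin k) →
      ∃ λ (T : Subset (size (cube n N))) → IsCopy B (cube n N) T ×
        ∃ λ (c : Fin k) → ∀ S → S ⊆ T → IsCopy A (cube n N) S → χ S ≡ c
  -- The value `χ ⊥` supplies the default colour.
  partition χ with gr (λ w → χ (image (embed A KA sA w))) (χ ⊥)
  ... | F , c , mono = image φ ,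
        (φ , φ-emb , λ z → ∈-image⁻ φ , ∈-image⁺ φ) , c , constant
    where
    φ = embed B KB sB F
    φ-emb = embed-isEmbedding B KB sB F
    constant : ∀ S → S ⊆ image φ → IsCopy A (cube n N) S → χ S ≡ c
    constant S S⊆T (h , h-emb , h-img) = trans (cong χ (⊆-antisym S⊆ ⊇S)) (mono g)
      where
      factor : ∀ x → ∃ λ y → φ y ≡ h x
      factor x = ∈-image⁻ φ (S⊆T (proj₂ (h-img (h x)) x refl))
      f : Fin (size A) → Fin (size B)
      f = proj₁ ∘ factor
      f-emb : IsEmbedding A B f
      f-emb = embedding-cancel A B (cube n N) φ-emb h-emb (proj₂ ∘ factor)
      g = embeddingWord A B KA KB sA sB f f-emb
      embed-g : ∀ x → embed A KA sA (comp id F g) x ≡ h x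
      embed-g x = trans (cong enc (trans
        (cong (_ ,_) (comp-assoc ρ₀ id F g (codeword A x)))
        (cong (move F) (move-embeddingWord A B KA KB sA sB f f-emb x)))) (proj₂ (factor x))
      S⊆ : S ⊆ image (embed A KA sA (comp id F g))
      S⊆ z∈S = let x , e = proj₁ (h-img _) z∈S in ∈-image⁺ _ x (trans (embed-g x) e)
      ⊇S : image (embed A KA sA (comp id F g)) ⊆ S
      ⊇S z∈ = let x , e = ∈-image⁻ _ z∈ in proj₂ (h-img _) x (trans (sym (embed-g x)) e)

theorem8p4 : (n : ℕ) → 1 ≤ n → RamseyProperty (InAge n)
theorem8p4 n _ k A B KA@(_ , loA , _) KB@(_ , loB , _)
  with ramsey-sorted k (sort A loA) (sort B loB)
         (relabel-inAge A (unrank A loA) (unrank-injective A loA) KA)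
         (relabel-inAge B (unrank B loB) (unrank-injective B loB) KB)
         (sort-sorted A loA) (sort-sorted B loB)
-- A structure and its sorted form have the same copies in `C`, so `C`, `T` and `c` carry over.
... | C , KC , partition = C , KC , λ χ →
      let T , copy , c , mono = partition χ in
      T , copy-unsort B loB {C} copy , c , λ S S⊆T copyA → mono S S⊆T (copy-sort A loA {C} copyA)
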